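{- Let $G$ be a finite, simple, connected graph on $\nu$ vertices with a perfect matching $M$. Suppose that for any vertices $x,y\in V(G)$ that are the two endvertices of some closed $M$-alternating path, $d(x)+d(y)\geq\nu-1$. Then $G$ has a closed $M$-alternating Hamilton path.
   Context: $d(x)$ is the degree of $x$. A perfect matching $M$ is a set of pairwise non-adjacent edges covering every vertex. An $M$-alternating path is a path whose edges lie alternately in $M$ and in $E(G)\setminus M$. A closed $M$-alternating path is either a single edge of $M$ or an $M$-alternating path whose first and last edges belong to $M$. A closed $M$-alternating Hamilton path is a closed $M$-alternating path containing all vertices of $G$. -}

module Defs where

open import Data.Nat using (ℕ; zero; suc; _+_; _≥_; _∸_)
open import Data.Fin using (Fin)
open import Data.List using (List; []; _∷_; length; filter)
open import Data.List.Relation.Unary.Unique.Propositional using (Unique)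
open import Data.List.Membership.Propositional using (_∈_)
open import Data.Product using (Σ; _×_; ∃; ∃-syntax; _,_)
open import Data.Empty using (⊥)
open import Data.Bool using (Bool; true; false)
open import Relation.Nullary using (¬_; Dec)
open import Relation.Unary using (Decidable)
open import Relation.Binary.PropositionalEquality using (_≡_)
open import Data.List.Base using (allFin)

record Graph (ν : ℕ) : Set₁ where
  field
    Adj     : Fin ν → Fin ν → Set
    adj?    : ∀ x y → Dec (Adj x y)
    sym     : ∀ {x y} → Adj x y → Adj y x
    irrefl  : ∀ {x} → ¬ Adj x x
open Graph public

module _ {ν : ℕ} (G : Graph ν) where

  deg : Fin ν → ℕ
  deg x = length (filter (adj? G x) (allFin ν))

  data IsWalk : List (Fin ν) → Set where
    w-nil  : IsWalk []
    w-one  : ∀ x → IsWalk (x ∷ [])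
    w-cons : ∀ {x y vs} → Adj G x y → IsWalk (y ∷ vs) → IsWalk (x ∷ y ∷ vs)

  IsPath : List (Fin ν) → Set
  IsPath vs = IsWalk vs × Unique vs

  Connected : Set
  Connected = ∀ x y → ∃[ vs ] (IsWalk (x ∷ vs) × Last x vs y)
    where
    Last : Fin ν → List (Fin ν) → Fin ν → Set
    Last x [] y = x ≡ y
    Last _ (z ∷ zs) y = Last z zs y

  record PerfectMatching : Set₁ where
    field
      InM     : Fin ν → Fin ν → Set
      M-sym   : ∀ {x y} → InM x y → InM y x
      M⊆E     : ∀ {x y} → InM x y → Adj G x y
      cover   : ∀ x → ∃[ y ] InM x y
      unique  : ∀ {x y z} → InM x y → InM x z → y ≡ z
  open PerfectMatching public

  module _ (M : PerfectMatching) where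

    Alt : Bool → List (Fin ν) → Set
    Alt _ [] = ⊤'
      where open import Data.Unit using () renaming (⊤ to ⊤')
    Alt _ (_ ∷ []) = ⊤'
      where open import Data.Unit using () renaming (⊤ to ⊤')
    Alt true  (x ∷ y ∷ vs) = InM M x y × Alt false (y ∷ vs)
    Alt false (x ∷ y ∷ vs) = ¬ InM M x y × Alt true (y ∷ vs)

    LastEdgeInM : List (Fin ν) → Set
    LastEdgeInM [] = ⊥
    LastEdgeInM (_ ∷ []) = ⊥
    LastEdgeInM (x ∷ y ∷ []) = InM M x y
    LastEdgeInM (_ ∷ y ∷ z ∷ vs) = LastEdgeInM (y ∷ z ∷ vs)

    -- closed M-alternating path: an M-alternating path (at least one edge)
    -- whose first and last edges belong to M (includes a single edge of M)
    IsClosedAltPath : List (Fin ν) → Set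
    IsClosedAltPath vs = IsPath vs × Alt true vs × LastEdgeInM vs

    Ends : List (Fin ν) → Fin ν → Fin ν → Set
    Ends [] _ _ = ⊥
    Ends (a ∷ vs) x y = x ≡ a × EndIs a vs y
      where
      EndIs : Fin ν → List (Fin ν) → Fin ν → Set
      EndIs a [] y = a ≡ y
      EndIs _ (b ∷ bs) y = EndIs b bs y

    IsClosedAltHamPath : List (Fin ν) → Set
    IsClosedAltHamPath vs = IsClosedAltPath vs × (∀ v → v ∈ vs)

{-# OPTIONS --safe #-}
-- Let P be a longest closed alternating path, with k edges of M, and suppose that it
-- misses a vertex. Let Q be a longest closed alternating path avoiding P, with q ≥ 1
-- edges of M and ends z, z′. Write P = u₁ v₁ … u_k v_k. If z ~ v_i and z′ ~ u_j with
-- i < j, then Q could replace the j − i − 1 edges of M in between, so j − i − 1 ≥ q; and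
-- z ~ v_i forces k − i ≥ q, z′ ~ u_j forces j − 1 ≥ q, as Q could replace an end of P.
-- Since z ~ v_i and z′ ~ u_{i+q} exclude each other, z sends to the v_i and z′ to the
-- u_i at most k − q edges together; the same holds with z and z′ exchanged. By
-- maximality of Q all other neighbours of z and z′ lie on Q, whence
-- d(z) + d(z′) ≤ 2(k − q) + 2(2q − 1) = 2(k + q) − 2 ≤ ν − 2, contrary to the hypothesis.
module Submission where

open import Defs
open import Data.Nat using (ℕ; _+_; _∸_; _≥_; _≤_)
open import Data.Fin using (Fin)
open import Data.List using (List)
open import Data.Product using (∃-syntax; _×_)

open import Data.Bool using (true)
open import Data.Empty using (⊥-elim)
open import Data.Fin using (fromℕ<)
open import Data.Fin.Properties using (_≟_; any?)
open import Data.List using ([]; _∷_; [_]; _++_; length; filter; take; drop; allFin)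
open import Data.List.Membership.DecPropositional using (_∈?_)
open import Data.List.Membership.Propositional using (_∈_; _∉_)
open import Data.List.Membership.Propositional.Properties
  using (∈-∃++; ∈-++⁻; ∈-++⁺ˡ; ∈-++⁺ʳ; ∈-filter⁺; ∈-filter⁻; ∈-allFin)
open import Data.List.Properties
  using (++-assoc; ++-identityʳ; length-++; length-take; length-drop;
         length-tabulate; take++drop≡id)
open import Data.List.Relation.Binary.Permutation.Propositional
  using (_↭_; ↭-sym; ↭-trans; ↭⇒↭ₛ)
open import Data.List.Relation.Binary.Permutation.Propositional.Properties
  using (++⁺ˡ; ++-comm; shift; shifts)
import Data.List.Relation.Binary.Permutation.Setoid.Properties as ↭ₛ
open import Data.List.Relation.Unary.All as All using (All; []; _∷_)
open import Data.List.Relation.Unary.AllPairs using (AllPairs; []; _∷_; allPairs?)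
open import Data.List.Relation.Unary.Any using (here; there)
open import Data.List.Relation.Unary.Linked as Linked using (Linked; []; [-]; _∷_; linked?)
open import Data.List.Relation.Unary.Unique.Propositional using (Unique)
open import Data.List.Relation.Unary.Unique.Propositional.Properties as Unique using (allFin⁺)
open import Data.Nat using (zero; suc; _<_; z≤n; s≤s; s≤s⁻¹)
open import Data.Nat.Properties hiding (_≟_)
open import Data.Nat.Tactic.RingSolver using (solve-∀)
open import Data.Product using (∃; _,_; proj₁; proj₂)
open import Data.Sum using (inj₁; inj₂)
open import Relation.Binary using (Symmetric)
open import Relation.Binary.PropositionalEquality as ≡
  using (_≡_; _≢_; refl; cong; cong₂; subst; trans)
open import Relation.Nullary using (¬_; Dec; yes; no)
open import Relation.Nullary.Decidable using (¬?; _×-dec_; map′; decidable-stable)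
open import Relation.Unary using (Decidable)

-- Finite lists: cardinality, pairwise and consecutive relations

private
  variable
    A : Set
    n : ℕ

count : {P : A → Set} → Decidable P → List A → ℕ
count P? xs = length (filter P? xs)

Unique-⊆⇒length≤ : {xs ys : List A} → Unique xs → (∀ {x} → x ∈ xs → x ∈ ys) →
  length xs ≤ length ys
Unique-⊆⇒length≤ [] sub = z≤n
Unique-⊆⇒length≤ {xs = x ∷ xs} (x∉ ∷ u) sub with ∈-∃++ (sub (here refl))
... | ys , zs , refl = begin
  suc (length xs)               ≤⟨ s≤s (Unique-⊆⇒length≤ u sub′) ⟩
  suc (length (ys ++ zs))       ≡⟨ cong suc (length-++ ys) ⟩
  suc (length ys + length zs)   ≡⟨ +-suc (length ys) (length zs) ⟨
  length ys + suc (length zs)   ≡⟨ length-++ ys ⟨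
  length (ys ++ x ∷ zs)         ∎
  where
  open ≤-Reasoning
  sub′ : ∀ {y} → y ∈ xs → y ∈ ys ++ zs
  sub′ y∈ with ∈-++⁻ ys (sub (there y∈))
  ... | inj₁ p = ∈-++⁺ˡ p
  ... | inj₂ (here refl) = ⊥-elim (All.lookup x∉ y∈ refl)
  ... | inj₂ (there p) = ∈-++⁺ʳ ys p

Unique⇒length≤ : {xs : List (Fin n)} → Unique xs → length xs ≤ n
Unique⇒length≤ {n} u =
  ≤-trans (Unique-⊆⇒length≤ u (λ {x} _ → ∈-allFin x)) (≤-reflexive (length-tabulate {n = n} _))

AllPairs-resp-↭ : {R : A → A → Set} → Symmetric R → {xs ys : List A} →
  xs ↭ ys → AllPairs R xs → AllPairs R ys
AllPairs-resp-↭ {A = A} {R = R} sym p =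
  ↭ₛ.AllPairs-resp-↭ (≡.setoid A) sym
    ((λ e → subst (R _) e) , (λ { refl r → r })) (↭⇒↭ₛ p)

AllPairs-++⁻ʳ : {R : A → A → Set} → ∀ xs {ys} → AllPairs R (xs ++ ys) → AllPairs R ys
AllPairs-++⁻ʳ []       ps       = ps
AllPairs-++⁻ʳ (x ∷ xs) (_ ∷ ps) = AllPairs-++⁻ʳ xs ps

Linked-++⁻ʳ : {R : A → A → Set} → ∀ xs {ys} → Linked R (xs ++ ys) → Linked R ys
Linked-++⁻ʳ []       rs = rs
Linked-++⁻ʳ (x ∷ xs) rs = Linked-++⁻ʳ xs (Linked.tail rs)

Linked-redirect : {R : A → A → Set} → ∀ xs {a ys b zs} →
  Linked R (xs ++ a ∷ ys) → R a b → Linked R (b ∷ zs) → Linked R (xs ++ a ∷ b ∷ zs)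
Linked-redirect []           _        r q = r ∷ q
Linked-redirect (x ∷ [])     (s ∷ _)  r q = s ∷ r ∷ q
Linked-redirect (x ∷ y ∷ xs) (s ∷ rs) r q = s ∷ Linked-redirect (y ∷ xs) rs r q

final : A → List A → A
final x []       = x
final x (y ∷ ys) = final y ys

final-∷ʳ : ∀ (x : A) ys z → final x (ys ++ [ z ]) ≡ z
final-∷ʳ x []       z = refl
final-∷ʳ x (y ∷ ys) z = final-∷ʳ y ys z

Linked-++ : {R : A → A → Set} → ∀ {x xs y ys} →
  Linked R (x ∷ xs) → R (final x xs) y → Linked R (y ∷ ys) → Linked R (x ∷ xs ++ y ∷ ys)
Linked-++ {xs = []}    _        r q = r ∷ q
Linked-++ {xs = _ ∷ _} (s ∷ rs) r q = s ∷ Linked-++ rs r q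

-- Longest lists by finite search

hasLength? : ∀ {P : List (Fin n) → Set} → Decidable P →
  ∀ k → Dec (∃[ xs ] (length xs ≡ k × P xs))
hasLength? P? zero = map′ (λ p → [] , refl , p) (λ { ([] , _ , p) → p }) (P? [])
hasLength? P? (suc k) =
  map′ (λ { (x , xs , e , p) → x ∷ xs , cong suc e , p })
       (λ { (x ∷ xs , e , p) → x , xs , suc-injective e , p })
       (any? λ x → hasLength? (λ xs → P? (x ∷ xs)) k)

-- If no list of length N has the property, the bound drops by one; at bound zero any witness is
-- longest.
longest : ∀ {P : List (Fin n) → Set} → Decidable P → ∀ N → (∀ xs → P xs → length xs ≤ N) →
  ∃ P → ∃[ xs ] (P xs × ∀ ys → P ys → length ys ≤ length xs)
longest P? zero    bound (xs , p) = xs , p , λ ys q → ≤-trans (bound ys q) z≤n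
longest P? (suc N) bound ∃P with hasLength? P? (suc N)
... | yes (xs , e , p) = xs , p , λ ys q → ≤-trans (bound ys q) (≤-reflexive (≡.sym e))
... | no ∄ = longest P? N (λ xs p → s≤s⁻¹ (≤∧≢⇒< (bound xs p) λ e → ∄ (xs , e , p))) ∃P

-- Counting positions that are kept apart by gaps

drop-suc : ∀ k (xs : List A) → drop (suc k) xs ≡ drop 1 (drop k xs)
drop-suc zero    xs       = refl
drop-suc (suc k) []       = refl
drop-suc (suc k) (x ∷ xs) = drop-suc k xs

module _ {V U : A → Set} (V? : Decidable V) (U? : Decidable U) where

  -- Every `U` has at least k elements before it, so dropping k elements loses none.
  count-drop : ∀ k xs → (∀ ys c zs → xs ≡ ys ++ c ∷ zs → U c → k ≤ length ys) →
    count U? xs ≤ count U? (drop k xs)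
  count-drop zero    xs       h = ≤-refl
  count-drop (suc k) []       h = z≤n
  count-drop (suc k) (x ∷ xs) h with U? x
  ... | yes u = ⊥-elim (n≮0 (h [] x xs refl u))
  ... | no  _ = count-drop k xs λ ys c zs e u → s≤s⁻¹ (h (x ∷ ys) c zs (cong (x ∷_) e) u)

  -- Pair each element with the one k + 1 places later: no pair has V on the left and
  -- U on the right.
  count-shifted : ∀ k xs →
    (∀ ys a zs → xs ≡ ys ++ a ∷ zs → V a → k < length zs) →
    (∀ ys a ws c zs → xs ≡ ys ++ a ∷ ws ++ c ∷ zs → V a → U c → k < length ws) →
    count V? xs + count U? (drop (suc k) xs) ≤ length (drop (suc k) xs)
  count-shifted k []       h₁ h₂ = z≤n
  count-shifted k (x ∷ xs) h₁ h₂
    -- The head of `drop k xs` is the partner of `x`, and by `drop-suc` the induction hypothesis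
    -- speaks of the tail.
    with drop k xs | drop-suc k xs | take++drop≡id k xs
       | count-shifted k xs (λ ys a zs e → h₁ (x ∷ ys) a zs (cong (x ∷_) e))
                            (λ ys a ws c zs e → h₂ (x ∷ ys) a ws c zs (cong (x ∷_) e))
  ... | ds | e | split | ih rewrite e with V? x | ds
  ...   | no  _ | []     = ih
  ...   | no  _ | d ∷ ds with U? d
  ...     | yes _ = ≤-trans (≤-reflexive (+-suc _ _)) (s≤s ih)
  ...     | no  _ = m≤n⇒m≤1+n ih
  count-shifted k (x ∷ xs) h₁ h₂ | ds | e | split | ih | yes v | [] =
    ⊥-elim (<-irrefl refl (<-≤-trans (h₁ [] x xs refl v)
      (≤-trans (≤-reflexive (cong length (trans (≡.sym split) (++-identityʳ _))))
               (≤-trans (≤-reflexive (length-take k xs)) (m⊓n≤m k _)))))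
  count-shifted k (x ∷ xs) h₁ h₂ | ds | e | split | ih | yes v | d ∷ ds′ with U? d
  ... | no  _ = s≤s ih
  ... | yes u =
    ⊥-elim (<-irrefl refl (<-≤-trans (h₂ [] x (take k xs) d ds′ (cong (x ∷_) (≡.sym split)) v u)
               (≤-trans (≤-reflexive (length-take k xs)) (m⊓n≤m k _))))

  -- The first `suc k` elements contain no `U`, so `count-shifted` sees every `U` although it only
  -- looks behind them.
  count-separated : ∀ k xs → k < length xs →
    (∀ ys c zs → xs ≡ ys ++ c ∷ zs → U c → k < length ys) →
    (∀ ys a zs → xs ≡ ys ++ a ∷ zs → V a → k < length zs) →
    (∀ ys a ws c zs → xs ≡ ys ++ a ∷ ws ++ c ∷ zs → V a → U c → k < length ws) →
    count V? xs + count U? xs + suc k ≤ length xs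
  count-separated k xs k< h₀ h₁ h₂ = begin
    count V? xs + count U? xs + suc k
      ≤⟨ +-monoˡ-≤ (suc k) (+-monoʳ-≤ (count V? xs) (count-drop (suc k) xs h₀)) ⟩
    count V? xs + count U? (drop (suc k) xs) + suc k
      ≤⟨ +-monoˡ-≤ (suc k) (count-shifted k xs h₁ h₂) ⟩
    length (drop (suc k) xs) + suc k
      ≡⟨ cong (_+ suc k) (length-drop (suc k) xs) ⟩
    length xs ∸ suc k + suc k
      ≡⟨ m∸n+n≡m k< ⟩
    length xs ∎
    where open ≤-Reasoning

-- Closed alternating paths as lists of blocks `x`, `mate x`

module _ {ν : ℕ} (G : Graph ν) (M : PerfectMatching G) where

  mate : Fin ν → Fin ν
  mate x = proj₁ (cover M x)

  matched : ∀ x → InM M x (mate x)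
  matched x = proj₂ (cover M x)

  mate-mate : ∀ x → mate (mate x) ≡ x
  mate-mate x = unique M (matched (mate x)) (M-sym M (matched x))

  mate-≢ : ∀ x → x ≢ mate x
  mate-≢ x e = irrefl G (M⊆E M (subst (InM M x) (≡.sym e) (matched x)))

  -- A closed alternating path x₁ (mate x₁) … x_k (mate x_k) is encoded by x₁ … x_k.
  expand : List (Fin ν) → List (Fin ν)
  expand []       = []
  expand (x ∷ xs) = x ∷ mate x ∷ expand xs

  -- A block is entered at `x` and left at `mate x`, so the relation is directed.
  Next : Fin ν → Fin ν → Set
  Next x y = Adj G (mate x) y

  -- Two inequalities make the edges of M at `x` and `y` disjoint, because `mate` is an involution.
  Apart : Fin ν → Fin ν → Set
  Apart x y = x ≢ y × mate x ≢ y

  -- One condition on `Q ++ P` says both that Q repeats no vertex and that it misses P. For empty P,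
  -- Q ranges over all closed alternating paths and the empty list.
  PathAvoiding : List (Fin ν) → List (Fin ν) → Set
  PathAvoiding P Q = Linked Next Q × AllPairs Apart (Q ++ P)

  Longest : List (Fin ν) → List (Fin ν) → Set
  Longest P Q = PathAvoiding P Q × ∀ xs → PathAvoiding P xs → length xs ≤ length Q

  pathAvoiding? : ∀ P → Decidable (PathAvoiding P)
  pathAvoiding? P Q =
    linked? (λ x → adj? G (mate x)) Q ×-dec
    allPairs? (λ x y → ¬? (x ≟ y) ×-dec ¬? (mate x ≟ y)) (Q ++ P)

  Apart-sym : Symmetric Apart
  Apart-sym {x} {y} (p , q) =
    (λ e → p (≡.sym e)) , (λ e → q (trans (cong mate (≡.sym e)) (mate-mate y)))

  Apart-mateˡ : ∀ {x y} → Apart x y → Apart (mate x) y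
  Apart-mateˡ {x} (p , q) = q , λ e → p (trans (≡.sym (mate-mate x)) e)

  expand-++ : ∀ xs ys → expand (xs ++ ys) ≡ expand xs ++ expand ys
  expand-++ []       ys = refl
  expand-++ (x ∷ xs) ys = cong (λ zs → x ∷ mate x ∷ zs) (expand-++ xs ys)

  length-expand : ∀ xs → length (expand xs) ≡ length xs + length xs
  length-expand []       = refl
  length-expand (x ∷ xs) =
    cong suc (trans (cong suc (length-expand xs)) (≡.sym (+-suc (length xs) (length xs))))

  ∉-expand⇒Apart : ∀ {x} xs → x ∉ expand xs → All (Apart x) xs
  ∉-expand⇒Apart []       x∉ = []
  ∉-expand⇒Apart (y ∷ xs) x∉ =
    Apart-sym ((λ e → x∉ (here (≡.sym e))) , λ e → x∉ (there (here (≡.sym e))))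
    ∷ ∉-expand⇒Apart xs (λ p → x∉ (there (there p)))

  Apart⇒∉-expand : ∀ {x xs} → All (Apart x) xs → All (x ≢_) (expand xs)
  Apart⇒∉-expand []       = []
  Apart⇒∉-expand (p ∷ ps) =
    proj₁ p ∷ (λ e → proj₂ (Apart-sym p) (≡.sym e)) ∷ Apart⇒∉-expand ps

  expand-unique : ∀ {xs} → AllPairs Apart xs → Unique (expand xs)
  expand-unique []       = []
  expand-unique {x ∷ xs} (p ∷ ps) =
    (mate-≢ x ∷ Apart⇒∉-expand p) ∷ Apart⇒∉-expand (All.map Apart-mateˡ p) ∷ expand-unique ps

  AllPairs-Apart⇒2·length≤ν : ∀ {xs} → AllPairs Apart xs → length xs + length xs ≤ ν
  AllPairs-Apart⇒2·length≤ν {xs} ps =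
    subst (_≤ ν) (length-expand xs) (Unique⇒length≤ (expand-unique ps))

  longestAvoiding : ∀ P → ∃ (PathAvoiding P) → ∃ (Longest P)
  longestAvoiding P = longest (pathAvoiding? P) ν λ xs (_ , ps) →
    ≤-trans (m≤m+n _ (length P)) (≤-trans (≤-reflexive (≡.sym (length-++ xs)))
      (≤-trans (m≤m+n _ _) (AllPairs-Apart⇒2·length≤ν ps)))

  expand-closedAltPath : ∀ {x xs} → Linked Next (x ∷ xs) → AllPairs Apart (x ∷ xs) →
    IsClosedAltPath G M (expand (x ∷ xs))
  expand-closedAltPath {x} {xs} ls ps = (walk ls , expand-unique ps) , alt ps , lastEdge x xs
    where
    walk : ∀ {xs} → Linked Next xs → IsWalk G (expand xs)
    walk []            = w-nil
    walk ([-] {x})     = w-cons (M⊆E M (matched x)) (w-one _)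
    walk (_∷_ {x} r l) = w-cons (M⊆E M (matched x)) (w-cons r (walk l))

    alt : ∀ {xs} → AllPairs Apart xs → Alt G M true (expand xs)
    alt []                   = _
    alt {x ∷ []}    _        = matched x , _
    alt {x ∷ y ∷ _} (((x≢y , _) ∷ _) ∷ ps) =
      -- Were the linking edge in M, `mate x` would be matched to both `x` and `y`.
      matched x , (λ m → x≢y (unique M (M-sym M (matched x)) m)) , alt ps

    lastEdge : ∀ x xs → LastEdgeInM G M (expand (x ∷ xs))
    lastEdge x []       = matched x
    lastEdge x (y ∷ []) = matched y
    lastEdge x (y ∷ z ∷ xs) = lastEdge y (z ∷ xs)

  expand-ends : ∀ x xs → Ends G M (expand (x ∷ xs)) x (mate (final x xs))
  expand-ends x []       = refl , refl
  expand-ends x (y ∷ xs) = refl , proj₂ (expand-ends y xs)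

  -- Reversal of a closed alternating path

  -- Read backwards, a path enters each block at its other vertex, hence the mates.
  rev : List (Fin ν) → List (Fin ν)
  rev []       = []
  rev (x ∷ xs) = rev xs ++ [ mate x ]

  length-rev : ∀ xs → length (rev xs) ≡ length xs
  length-rev []       = refl
  length-rev (x ∷ xs) = trans (length-++ (rev xs)) (trans (+-comm _ 1) (cong suc (length-rev xs)))

  -- Exposes both outer blocks of the reversed path, which shows later that reversal exchanges z and
  -- z′.
  rev-∷ : ∀ x xs → ∃[ ys ]
    (rev (x ∷ xs) ≡ mate (final x xs) ∷ ys × final (mate (final x xs)) ys ≡ mate x)
  rev-∷ x []       = [] , refl , refl
  rev-∷ x (y ∷ xs) with rev-∷ y xs
  ... | ys , e , _ = ys ++ [ mate x ] , cong (_++ [ mate x ]) e , final-∷ʳ _ ys (mate x)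

  rev-linked : ∀ {xs} → Linked Next xs → Linked Next (rev xs)
  rev-linked []  = []
  rev-linked [-] = [-]
  rev-linked {x ∷ y ∷ xs} (r ∷ rs) with rev (y ∷ xs) | rev-linked rs | rev-∷ y xs
  ... | _ | ls | ys , refl , e =
    -- The last block so far is left at `y`, from which `r` read backwards leads to `mate x`.
    Linked-++ ls
      (subst (λ z → Adj G (mate z) (mate x)) (≡.sym e)
        (subst (λ z → Adj G z (mate x)) (≡.sym (mate-mate y)) (sym G r)))
      [-]

  rev-apart : ∀ xs {ys} → AllPairs Apart (xs ++ ys) → AllPairs Apart (rev xs ++ ys)
  rev-apart []       ps            = ps
  rev-apart (x ∷ xs) {ys} (p ∷ ps) =
    subst (AllPairs Apart) (≡.sym (++-assoc (rev xs) [ mate x ] ys))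
      (rev-apart xs (AllPairs-resp-↭ Apart-sym (↭-sym (shift (mate x) xs ys))
        (All.map Apart-mateˡ p ∷ ps)))

  rev-longest : ∀ {P Q} → Longest P Q → Longest P (rev Q)
  rev-longest {P} {Q} ((ls , ps) , max) =
    (rev-linked ls , rev-apart Q ps) ,
    λ xs p → subst (length xs ≤_) (≡.sym (length-rev Q)) (max xs p)

  -- Neighbours of an end of a longest path

  count-expand : {R : Fin ν → Set} (R? : Decidable R) → ∀ xs →
    count R? (expand xs) ≡ count R? xs + count (λ x → R? (mate x)) xs
  count-expand R? []       = refl
  count-expand R? (x ∷ xs) with count-expand R? xs | R? x
  count-expand R? (x ∷ xs) | ih | yes _ with R? (mate x)
  ... | yes _ = cong suc (trans (cong suc ih) (≡.sym (+-suc _ _)))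
  ... | no _  = cong suc ih
  count-expand R? (x ∷ xs) | ih | no _ with R? (mate x)
  ... | yes _ = trans (cong suc ih) (≡.sym (+-suc _ _))
  ... | no _  = ih

  -- A neighbour `w` off both paths would allow the block `mate w`, `w` to be put in front of `z`,
  -- giving a longer path that avoids P.
  longest-neighbours : ∀ {P z Q} → Longest P (z ∷ Q) → ∀ {w} → Adj G z w →
    w ∈ mate z ∷ expand Q ++ expand P
  longest-neighbours {P} {z} {Q} ((ls , ps) , max) {w} a
    with _∈?_ _≟_ w (expand (z ∷ Q ++ P))
  ... | yes (here refl) = ⊥-elim (irrefl G a)
  ... | yes (there w∈) = subst (λ xs → w ∈ mate z ∷ xs) (expand-++ Q P) w∈
  ... | no w∉ = ⊥-elim (1+n≰n (max (mate w ∷ z ∷ Q)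
          ( subst (λ v → Adj G v z) (≡.sym (mate-mate w)) (sym G a) ∷ ls
          , All.map Apart-mateˡ (∉-expand⇒Apart (z ∷ Q ++ P) w∉) ∷ ps)))

  -- Since `z` is not its own neighbour, its path contributes at most 2q - 1; the `suc` on the left
  -- records this without subtraction.
  deg-bound : ∀ {P z Q} → Longest P (z ∷ Q) →
    suc (deg G z) ≤ count (λ x → adj? G z (mate x)) P + count (adj? G z) P
                    + (length (z ∷ Q) + length (z ∷ Q))
  deg-bound {P} {z} {Q} Q-longest = begin
    suc (deg G z)
      ≤⟨ s≤s (Unique-⊆⇒length≤ (Unique.filter⁺ (adj? G z) (allFin⁺ ν)) neighbours) ⟩
    suc (length ((mate z ∷ expand Q) ++ filter (adj? G z) (expand P)))
      ≡⟨ cong suc (length-++ (mate z ∷ expand Q)) ⟩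
    length (expand (z ∷ Q)) + count (adj? G z) (expand P)
      ≡⟨ cong₂ _+_ (length-expand (z ∷ Q)) (count-expand (adj? G z) P) ⟩
    (length (z ∷ Q) + length (z ∷ Q)) + (count (adj? G z) P + count (λ x → adj? G z (mate x)) P)
      ≡⟨ +-comm (length (z ∷ Q) + length (z ∷ Q)) _ ⟩
    (count (adj? G z) P + count (λ x → adj? G z (mate x)) P) + (length (z ∷ Q) + length (z ∷ Q))
      ≡⟨ cong (_+ (length (z ∷ Q) + length (z ∷ Q))) (+-comm (count (adj? G z) P) _) ⟩
    count (λ x → adj? G z (mate x)) P + count (adj? G z) P + (length (z ∷ Q) + length (z ∷ Q)) ∎
    where
    open ≤-Reasoning
    neighbours : ∀ {w} → w ∈ filter (adj? G z) (allFin ν) →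
      w ∈ (mate z ∷ expand Q) ++ filter (adj? G z) (expand P)
    neighbours w∈ with proj₂ (∈-filter⁻ (adj? G z) {xs = allFin ν} w∈)
    ... | a with ∈-++⁻ (mate z ∷ expand Q) (longest-neighbours Q-longest a)
    ...   | inj₁ p = ∈-++⁺ˡ p
    ...   | inj₂ p = ∈-++⁺ʳ (mate z ∷ expand Q) (∈-filter⁺ (adj? G z) p a)

  -- Exchanging a segment of P for Q

  -- As Q avoids P, putting it in place of `bs` yields another path, which cannot be longer than P.
  splice : ∀ {P} as bs cs Q → P ≡ as ++ bs ++ cs → Longest [] P →
    AllPairs Apart (Q ++ P) → Linked Next (as ++ Q ++ cs) → length Q ≤ length bs
  splice as bs cs Q refl (_ , max) ps ls =
    +-cancelʳ-≤ (length cs) _ _ (+-cancelˡ-≤ (length as) _ _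
      (≤-trans (≤-reflexive (≡.sym (length₃ Q)))
        (≤-trans (max (as ++ Q ++ cs) (ls , subst (AllPairs Apart) (≡.sym (++-identityʳ _)) ps′))
          (≤-reflexive (length₃ bs)))))
    where
    length₃ : ∀ xs → length (as ++ xs ++ cs) ≡ length as + (length xs + length cs)
    length₃ xs = trans (length-++ as) (cong (length as +_) (length-++ xs))
    ps′ : AllPairs Apart (as ++ Q ++ cs)
    -- `Apart` is symmetric, so `bs` may be moved to the front and dropped there.
    ps′ = AllPairs-++⁻ʳ bs (AllPairs-resp-↭ Apart-sym
            (↭-trans (++⁺ˡ Q (shifts as bs)) (↭-trans (shifts Q bs) (++⁺ˡ bs (shifts Q as)))) ps)

  module _ {P : List (Fin ν)} (P-longest : Longest [] P)
           {z : Fin ν} {Q : List (Fin ν)} (Q-path : PathAvoiding P (z ∷ Q)) where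

    private
      z′ : Fin ν
      z′ = mate (final z Q)

    -- With k = q - 1, the hypotheses of `count-separated` say that q blocks fit into, in turn, all
    -- of P, the part before a neighbour of z′, the part after a block left at a neighbour of z, and
    -- the part between two such blocks.
    crossing-bound :
      count (λ x → adj? G z (mate x)) P + count (adj? G z′) P + length (z ∷ Q) ≤ length P
    crossing-bound = count-separated (λ x → adj? G z (mate x)) (adj? G z′) (length Q) P
      (proj₂ P-longest (z ∷ Q) alone)
      (λ bs c cs e u → splice [] bs (c ∷ cs) (z ∷ Q) e P-longest apart
        (Linked-++ linked u (Linked-++⁻ʳ bs (subst (Linked Next) e P-linked))))
      (λ as a bs e v →
        insertAfter as a bs [] (trans e (cong (λ xs → as ++ a ∷ xs) (≡.sym (++-identityʳ bs)))) v
          (subst (Linked Next) (≡.sym (++-identityʳ (z ∷ Q))) linked))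
      (λ as a bs c cs e v u → insertAfter as a bs (c ∷ cs) e v
        (Linked-++ linked u
          (Linked-++⁻ʳ (a ∷ bs) (Linked-++⁻ʳ as (subst (Linked Next) e P-linked)))))
      where
      linked : Linked Next (z ∷ Q)
      linked = proj₁ Q-path

      apart : AllPairs Apart (z ∷ Q ++ P)
      apart = proj₂ Q-path

      P-linked : Linked Next P
      P-linked = proj₁ (proj₁ P-longest)

      alone : PathAvoiding [] (z ∷ Q)
      alone = linked , subst (AllPairs Apart) (≡.sym (++-identityʳ (z ∷ Q)))
        (AllPairs-++⁻ʳ P (AllPairs-resp-↭ Apart-sym (++-comm (z ∷ Q) P) apart))

      insertAfter : ∀ as a bs cs → P ≡ as ++ a ∷ bs ++ cs → Adj G z (mate a) →
        Linked Next ((z ∷ Q) ++ cs) → length (z ∷ Q) ≤ length bs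
      insertAfter as a bs cs e v ls =
        splice (as ++ [ a ]) bs cs (z ∷ Q)
          (trans e (≡.sym (++-assoc as [ a ] (bs ++ cs)))) P-longest apart
          (subst (Linked Next) (≡.sym (++-assoc as [ a ] _))
            (Linked-redirect as (subst (Linked Next) e P-linked) (sym G v) ls))

  -- The degree condition leaves no vertex outside P

  EndDegreeCondition : Set
  EndDegreeCondition = ∀ x y → ∃[ vs ] (IsClosedAltPath G M vs × Ends G M vs x y) →
    deg G x + deg G y ≥ ν ∸ 1

  module _ (degreeSum : EndDegreeCondition) {P : List (Fin ν)} (P-longest : Longest [] P) where

    ¬longest-outside : ∀ {z Q} → ¬ Longest P (z ∷ Q)
    ¬longest-outside {z} {Q} Q-longest@((ls , ps) , _)
      -- The reversed path is also longest and starts at z′, so the bounds for a first vertex apply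
      -- to z′ too.
      with rev (z ∷ Q) | rev-longest Q-longest | length-rev (z ∷ Q) | rev-∷ z Q
    ... | _ | Q′-longest | same-length | Q′ , refl , e =
      -- From ν ≤ 1 + (ν ∸ 1) the hypothesis gives ν ≤ 1 + d(z) + d(z′), one short of `2+degrees≤ν`.
      1+n≰n (≤-trans 2+degrees≤ν (≤-trans (m≤n+m∸n ν 1) (s≤s (degreeSum z z′ path))))
      where
      open ≤-Reasoning
      z′ = mate (final z Q)
      k = length P
      q = length (z ∷ Q)
      -- The numbers of blocks of P from which an edge leads to `v`, and to which an edge leads from
      -- `v`.
      preceding following : Fin ν → ℕ
      preceding v = count (λ x → adj? G v (mate x)) P
      following v = count (adj? G v) P

      path : ∃[ vs ] (IsClosedAltPath G M vs × Ends G M vs z z′)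
      path = expand (z ∷ Q) , expand-closedAltPath ls ps′ , expand-ends z Q
        where
        ps′ = AllPairs-++⁻ʳ P (AllPairs-resp-↭ Apart-sym (++-comm (z ∷ Q) P) ps)

      forward : preceding z + following z′ + q ≤ k
      forward = crossing-bound P-longest (proj₁ Q-longest)

      backward : preceding z′ + following z + q ≤ k
      -- The far end of the reversed path is `mate (mate z)`, that is, z.
      backward = subst (λ m → preceding z′ + following z + m ≤ k) same-length
        (subst (λ v → preceding z′ + following v + length (z′ ∷ Q′) ≤ k)
          (trans (cong mate e) (mate-mate z)) (crossing-bound P-longest (proj₁ Q′-longest)))

      regroup : ∀ a b c d q → (a + d + (q + q)) + (c + b + (q + q))
                              ≡ ((a + b + q) + (c + d + q)) + (q + q)
      regroup = solve-∀

      regroup′ : ∀ k q → (k + k) + (q + q) ≡ (q + k) + (q + k)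
      regroup′ = solve-∀

      2+degrees≤ν : 2 + (deg G z + deg G z′) ≤ ν
      2+degrees≤ν = begin
        2 + (deg G z + deg G z′)
          ≡⟨ cong suc (+-suc (deg G z) (deg G z′)) ⟨
        suc (deg G z) + suc (deg G z′)
          ≤⟨ +-mono-≤ (deg-bound Q-longest)
               (subst (λ m → suc (deg G z′) ≤ preceding z′ + following z′ + (m + m))
                 same-length (deg-bound Q′-longest)) ⟩
        (preceding z + following z + (q + q)) + (preceding z′ + following z′ + (q + q))
          -- Degrees pair the two counts at one end, crossing bounds the counts at opposite ends;
          -- two of the four q enter the crossing bounds.
          ≡⟨ regroup (preceding z) (following z′) (preceding z′) (following z) q ⟩
        ((preceding z + following z′ + q) + (preceding z′ + following z + q)) + (q + q)
          ≤⟨ +-monoˡ-≤ (q + q) (+-mono-≤ forward backward) ⟩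
        (k + k) + (q + q)
          ≡⟨ regroup′ k q ⟩
        (q + k) + (q + k)
          ≡⟨ cong₂ _+_ (length-++ (z ∷ Q)) (length-++ (z ∷ Q)) ⟨
        length (z ∷ Q ++ P) + length (z ∷ Q ++ P)
          ≤⟨ AllPairs-Apart⇒2·length≤ν ps ⟩
        ν ∎

    -- A missed vertex `v` gives the one-block path `[ v ]` avoiding P, so a longest such path would
    -- be nonempty.
    longest-spans : ∀ v → v ∈ expand P
    longest-spans v = decidable-stable (_∈?_ _≟_ v (expand P)) uncovered
      where
      single : v ∉ expand P → PathAvoiding P [ v ]
      single v∉ = [-] , ∉-expand⇒Apart P v∉
        ∷ subst (AllPairs Apart) (++-identityʳ P) (proj₂ (proj₁ P-longest))

      uncovered : ¬ v ∉ expand P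
      uncovered v∉ with longestAvoiding P ([ v ] , single v∉)
      ... | []    , _ , max = n≮0 (max [ v ] (single v∉))
      ... | z ∷ Q , Q-longest = ¬longest-outside Q-longest

theorem3p1 : (ν : ℕ) → 1 ≤ ν → (G : Graph ν) → Connected G → (M : PerfectMatching G) →
    (∀ x y → ∃[ vs ] (IsClosedAltPath G M vs × Ends G M vs x y) →
    deg G x + deg G y ≥ ν ∸ 1) →
    ∃[ vs ] IsClosedAltHamPath G M vs
theorem3p1 ν 1≤ν G _ M degreeSum
  with longestAvoiding G M [] ([] , [] , [])
-- An empty P would have to contain the vertex that `1 ≤ ν` provides.
... | [] , P-longest with longest-spans G M degreeSum P-longest (fromℕ< 1≤ν)
...   | ()
theorem3p1 ν 1≤ν G _ M degreeSum | x ∷ P , P-longest@((ls , ps) , _) =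
  expand G M (x ∷ P) ,
  expand-closedAltPath G M ls (subst (AllPairs (Apart G M)) (++-identityʳ (x ∷ P)) ps) ,
  longest-spans G M degreeSum P-longest
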